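{- Let $q$ be a prime power, let $m,n\ge 1$, and let $\mathcal{C}$ be an $[n,k,d]_{q^m/q}$ code. If $\mathcal{C}$ is minimal, then $\mathcal{C}$ is a $(2,1)$-separating rank-metric code.
   Context: Support and rank: fix an $\mathbb{F}_q$-basis $\Gamma$ of $\mathbb{F}_{q^m}$. For $x=(x_1,\dots,x_n)\in\mathbb{F}_{q^m}^n$ let $\mathrm{Mat}_\Gamma(x)\in\mathbb{F}_q^{m\times n}$ be the matrix whose $j$-th column is the coordinate vector of $x_j$ in the basis $\Gamma$. The support $\sigma(x)\subseteq\mathbb{F}_q^n$ is the $\mathbb{F}_q$-row space of $\mathrm{Mat}_\Gamma(x)$, and $\mathrm{rk}(x)=\dim_{\mathbb{F}_q}\sigma(x)$; both are independent of $\Gamma$. An $[n,k,d]_{q^m/q}$ code is an $\mathbb{F}_{q^m}$-linear subspace $\mathcal{C}$ of $\mathbb{F}_{q^m}^n$ with $k=\dim_{\mathbb{F}_{q^m}}\mathcal{C}\ge 1$ and minimum distance $d=\min_{c\in\mathcal{C}\setminus\{0\}}\mathrm{rk}(c)$. The code is minimal if for all nonzero $c,c'\in\mathcal{C}$, $\sigma(c)\subseteq\sigma(c')$ implies $c'=\lambda c$ for some $\lambda\in\mathbb{F}_{q^m}$. A subset $\mathcal{C}\subseteq\mathbb{F}_{q^m}^n$ is a $(2,1)$-separating rank-metric code if all pairwise distinct $x,y,z\in\mathcal{C}$ satisfy $\mathrm{rk}(x-z)<\mathrm{rk}(x-y)+\mathrm{rk}(y-z)$. -}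

module Defs where

open import Algebra.Bundles using (CommutativeRing)
open import Algebra.Module.Bundles using (Module)
open import Algebra.Module.Structures.Biased using (IsModuleFromLeft)
open import Algebra.Morphism.Structures using (module RingMorphisms)
import Algebra.Properties.AbelianGroup as AbelianGroupProperties
import Algebra.Properties.CommutativeMonoid.Sum as Sum
open import Data.Fin.Base using (Fin; zero; suc)
import Data.Fin.Properties as Fin
open import Data.Nat.Base using (ℕ; zero; suc; _≤_; _<_; _^_) renaming (_+_ to _+ℕ_)
open import Data.Nat.Primality using (Prime)
open import Data.Product.Base using (Σ; ∃; ∃-syntax; _×_; _,_; proj₁; proj₂)
open import Data.Vec.Functional using (Vector; []; _∷_; head; tail)
open import Function.Base using (_∘_)
open import Function.Bundles using (Inverse)
open import Level using (Level; _⊔_) renaming (suc to lsuc)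
open import Relation.Binary.Definitions using (Decidable)
open import Relation.Binary.PropositionalEquality as ≡ using (_≡_)
import Relation.Binary.Reasoning.Setoid as SetoidReasoning
open import Relation.Nullary using (¬_; Dec; yes; no; contradiction)
open import Relation.Nullary.Decidable using (map′)
open import Relation.Unary using (Pred; _∈_; _⊆_; U)

IsPrimePower : ℕ → Set
IsPrimePower q = ∃[ p ] ∃[ e ] Prime p × 1 ≤ e × q ≡ p ^ e

-- A field with exactly q elements; these are counted up to the ring's own
-- equality _≈_, which therefore is decidable.

record FiniteField (q : ℕ) (c ℓ : Level) : Set (lsuc (c ⊔ ℓ)) where
  field
    commutativeRing : CommutativeRing c ℓ
  open CommutativeRing commutativeRing public
  field
    0≉1         : ¬ (0# ≈ 1#)
    inverse     : ∀ x → ¬ (x ≈ 0#) → ∃[ y ] x * y ≈ 1#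
    enumeration : Inverse setoid (≡.setoid (Fin q))

  private module Enum = Inverse enumeration

  _≈?_ : Decidable _≈_
  x ≈? y = map′ injective Enum.to-cong (Enum.to x Fin.≟ Enum.to y)
    where
    injective : Enum.to x ≡ Enum.to y → x ≈ y
    injective eq = trans (sym (Enum.inverseʳ ≡.refl))
                         (trans (Enum.from-cong eq) (Enum.inverseʳ ≡.refl))

  any? : ∀ {p} {P : Pred Carrier p} → (∀ {x y} → x ≈ y → P x → P y) →
         (∀ x → Dec (P x)) → Dec (∃ P)
  any? {P = P} resp P? = map′
    (λ (i , px) → Enum.from i , px)
    (λ (x , px) → Enum.to x , resp (sym (Enum.inverseʳ ≡.refl)) px)
    (Fin.any? (λ i → P? (Enum.from i)))

  anyVector? : ∀ {p} k {P : Pred (Vector Carrier k) p} →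
               (∀ {u v} → (∀ i → u i ≈ v i) → P u → P v) →
               (∀ v → Dec (P v)) → Dec (∃ P)
  anyVector? zero    resp P? = map′ (λ p → [] , p)
                                    (λ (v , pv) → resp (λ ()) pv) (P? [])
  anyVector? (suc k) {P} resp P? = map′
    (λ (a , v , p) → a ∷ v , p)
    (λ (v , pv) → head v , tail v , resp (λ { zero → refl ; (suc _) → refl }) pv)
    (any? (λ x≈y (v , p) → v , resp (λ { zero → x≈y ; (suc _) → refl }) p)
          (λ a → anyVector? k
             (λ u≈v → resp (λ { zero → refl ; (suc i) → u≈v i }))
             (λ v → P? (a ∷ v))))

module _ {c ℓ} (R : CommutativeRing c ℓ) where
  open CommutativeRing R

  infix 9 _^ᴹ_

  _^ᴹ_ : ℕ → Module R c ℓ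
  _^ᴹ_ n = record
    { Carrierᴹ = Vector Carrier n
    ; _≈ᴹ_ = λ u v → ∀ i → u i ≈ v i
    ; _+ᴹ_ = λ u v i → u i + v i
    ; _*ₗ_ = λ a v i → a * v i
    ; _*ᵣ_ = λ v a i → a * v i
    ; 0ᴹ = λ _ → 0#
    ; -ᴹ_ = λ v i → - v i
    ; isModule = IsModuleFromLeft.isModule {commutativeRing = R} record
      { isLeftModule = record
        { isLeftSemimodule = record
          { +ᴹ-isCommutativeMonoid = record
            { isMonoid = record
              { isSemigroup = record
                { isMagma = record
                  { isEquivalence = record
                    { refl = λ _ → refl
                    ; sym = λ p i → sym (p i)
                    ; trans = λ p q i → trans (p i) (q i)
                    }
                  ; ∙-cong = λ p q i → +-cong (p i) (q i)
                  }
                ; assoc = λ _ _ _ _ → +-assoc _ _ _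
                }
              ; identity = (λ _ _ → +-identityˡ _) , (λ _ _ → +-identityʳ _)
              }
            ; comm = λ _ _ _ → +-comm _ _
            }
          ; isPreleftSemimodule = record
            { *ₗ-cong = λ p q i → *-cong p (q i)
            ; *ₗ-zeroˡ = λ _ _ → zeroˡ _
            ; *ₗ-distribʳ = λ _ _ _ _ → distribʳ _ _ _
            ; *ₗ-identityˡ = λ _ _ → *-identityˡ _
            ; *ₗ-assoc = λ _ _ _ _ → *-assoc _ _ _
            ; *ₗ-zeroʳ = λ _ _ → zeroʳ _
            ; *ₗ-distribˡ = λ _ _ _ _ → distribˡ _ _ _
            }
          }
        ; -ᴹ‿cong = λ p i → -‿cong (p i)
        ; -ᴹ‿inverse = (λ _ _ → -‿inverseˡ _) , (λ _ _ → -‿inverseʳ _)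
        }
      }
    }

module _ {c₁ ℓ₁ c₂ ℓ₂} (R : CommutativeRing c₁ ℓ₁) (S : CommutativeRing c₂ ℓ₂) where
  private
    module R = CommutativeRing R
    module S = CommutativeRing S

  record RingHomomorphism : Set (c₁ ⊔ ℓ₁ ⊔ c₂ ⊔ ℓ₂) where
    open RingMorphisms R.rawRing S.rawRing using (IsRingHomomorphism)
    field
      ⟦_⟧                : R.Carrier → S.Carrier
      isRingHomomorphism : IsRingHomomorphism ⟦_⟧
    open IsRingHomomorphism isRingHomomorphism public

  restrictScalars : RingHomomorphism → Module R c₂ ℓ₂
  restrictScalars ι = record
    { Carrierᴹ = S.Carrier
    ; _≈ᴹ_ = S._≈_
    ; _+ᴹ_ = S._+_
    ; _*ₗ_ = λ a x → ⟦ a ⟧ S.* x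
    ; _*ᵣ_ = λ x a → ⟦ a ⟧ S.* x
    ; 0ᴹ = S.0#
    ; -ᴹ_ = S.-_
    ; isModule = IsModuleFromLeft.isModule {commutativeRing = R} record
      { isLeftModule = record
        { isLeftSemimodule = record
          { +ᴹ-isCommutativeMonoid = S.+-isCommutativeMonoid
          ; isPreleftSemimodule = record
            { *ₗ-cong = λ p q → S.*-cong (⟦⟧-cong p) q
            ; *ₗ-zeroˡ = λ x → S.trans (S.*-congʳ 0#-homo) (S.zeroˡ x)
            ; *ₗ-distribʳ = λ x a b → S.trans (S.*-congʳ (+-homo a b)) (S.distribʳ x _ _)
            ; *ₗ-identityˡ = λ x → S.trans (S.*-congʳ 1#-homo) (S.*-identityˡ x)
            ; *ₗ-assoc = λ a b x → S.trans (S.*-congʳ (*-homo a b)) (S.*-assoc _ _ x)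
            ; *ₗ-zeroʳ = λ _ → S.zeroʳ _
            ; *ₗ-distribˡ = λ _ → S.distribˡ _
            }
          }
        ; -ᴹ‿cong = S.-‿cong
        ; -ᴹ‿inverse = S.-‿inverse
        }
      }
    }
    where open RingHomomorphism ι

module LinearAlgebra {c ℓ m ℓm} {R : CommutativeRing c ℓ} (V : Module R m ℓm) where
  open CommutativeRing R
  open Module V
  open Sum +ᴹ-commutativeMonoid using (sum)

  combination : ∀ {k} → Vector Carrier k → Vector Carrierᴹ k → Carrierᴹ
  combination a v = sum (λ i → a i *ₗ v i)

  LinearlyIndependent : ∀ {k} → Vector Carrierᴹ k → Set _
  LinearlyIndependent v = ∀ a → combination a v ≈ᴹ 0ᴹ → ∀ i → a i ≈ 0#

  Span : ∀ {k} → Vector Carrierᴹ k → Pred Carrierᴹ _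
  Span v x = ∃[ a ] x ≈ᴹ combination a v

  record IsSubspace {p} (W : Pred Carrierᴹ p) : Set (c ⊔ m ⊔ ℓm ⊔ p) where
    field
      resp      : ∀ {x y} → x ≈ᴹ y → x ∈ W → y ∈ W
      0-closed  : 0ᴹ ∈ W
      +-closed  : ∀ {x y} → x ∈ W → y ∈ W → x +ᴹ y ∈ W
      *ₗ-closed : ∀ a {x} → x ∈ W → a *ₗ x ∈ W

  record IsBasis {p k} (W : Pred Carrierᴹ p) (b : Vector Carrierᴹ k)
                 : Set (c ⊔ ℓ ⊔ m ⊔ ℓm ⊔ p) where
    field
      members     : ∀ i → b i ∈ W
      independent : LinearlyIndependent b
      spanning    : W ⊆ Span b

  HasDimension : ∀ {p} → Pred Carrierᴹ p → ℕ → Set _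
  HasDimension W k = Σ (Vector Carrierᴹ k) (IsBasis W)

-- Over a finite field every finitely generated space has a basis, so that its
-- dimension can be extracted as a natural number.

module FiniteDimension {q c ℓ m ℓm} (F : FiniteField q c ℓ)
  (V : Module (FiniteField.commutativeRing F) m ℓm)
  (_≈ᴹ?_ : Decidable (Module._≈ᴹ_ V)) where

  open FiniteField F hiding (zero)
  open Module V
  open LinearAlgebra V
  open Sum +ᴹ-commutativeMonoid
    using (sum; sum-cong-≋; ∑-distrib-+; sum-replicate-zero)
  open SetoidReasoning ≈ᴹ-setoid
  open AbelianGroupProperties +ᴹ-abelianGroup using (inverseˡ-unique)

  combination-cong : ∀ {k} {a a′ : Vector Carrier k} (v : Vector Carrierᴹ k) →
                     (∀ i → a i ≈ a′ i) → combination a v ≈ᴹ combination a′ v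
  combination-cong v a≈a′ = sum-cong-≋ (λ i → *ₗ-congʳ (a≈a′ i))

  combination-* : ∀ {k} s (a : Vector Carrier k) v →
                  s *ₗ combination a v ≈ᴹ combination (λ i → s * a i) v
  combination-* {zero}  s a v = *ₗ-zeroʳ s
  combination-* {suc k} s a v = begin
    s *ₗ (head a *ₗ head v +ᴹ combination (tail a) (tail v))
      ≈⟨ *ₗ-distribˡ s _ _ ⟩
    s *ₗ (head a *ₗ head v) +ᴹ s *ₗ combination (tail a) (tail v)
      ≈⟨ +ᴹ-cong (≈ᴹ-sym (*ₗ-assoc s _ _)) (combination-* s (tail a) (tail v)) ⟩
    combination (λ i → s * a i) v ∎

  combination-+ : ∀ {k} (a a′ : Vector Carrier k) v →
                  combination a v +ᴹ combination a′ v ≈ᴹ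
                  combination (λ i → a i + a′ i) v
  combination-+ {k} a a′ v = begin
    combination a v +ᴹ combination a′ v
      ≈⟨ ∑-distrib-+ (λ i → a i *ₗ v i) (λ i → a′ i *ₗ v i) ⟨
    sum (λ i → a i *ₗ v i +ᴹ a′ i *ₗ v i)
      ≈⟨ sum-cong-≋ (λ i → ≈ᴹ-sym (*ₗ-distribʳ (v i) (a i) (a′ i))) ⟩
    combination (λ i → a i + a′ i) v ∎

  ∈Span? : ∀ {k} (b : Vector Carrierᴹ k) x → Dec (x ∈ Span b)
  ∈Span? {k} b x = anyVector? k
    (λ u≈v x≈u → ≈ᴹ-trans x≈u (combination-cong b u≈v))
    (λ a → x ≈ᴹ? combination a b)

  tail⊆Span : ∀ {k} (v : Vector Carrierᴹ (suc k)) → Span (tail v) ⊆ Span v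
  tail⊆Span v (a , x≈) = 0# ∷ a , ≈ᴹ-trans x≈
    (≈ᴹ-sym (≈ᴹ-trans (+ᴹ-congʳ (*ₗ-zeroˡ (head v))) (+ᴹ-identityˡ _)))

  head∈Span : ∀ {k} (v : Vector Carrierᴹ (suc k)) → head v ∈ Span v
  head∈Span {k} v = 1# ∷ (λ _ → 0#) , ≈ᴹ-sym (begin
    1# *ₗ head v +ᴹ combination (λ _ → 0#) (tail v)
      ≈⟨ +ᴹ-cong (*ₗ-identityˡ _) (sum-cong-≋ (λ i → *ₗ-zeroˡ (tail v i))) ⟩
    head v +ᴹ sum {k} (λ _ → 0ᴹ)
      ≈⟨ +ᴹ-congˡ (sum-replicate-zero k) ⟩
    head v +ᴹ 0ᴹ
      ≈⟨ +ᴹ-identityʳ _ ⟩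
    head v ∎)

  combine∈Span : ∀ {k} (b : Vector Carrierᴹ k) s {x y} →
                 x ∈ Span b → y ∈ Span b → s *ₗ x +ᴹ y ∈ Span b
  combine∈Span b s (a , x≈) (a′ , y≈) = (λ i → s * a i + a′ i) ,
    ≈ᴹ-trans (+ᴹ-cong (≈ᴹ-trans (*ₗ-congˡ x≈) (combination-* s a b)) y≈)
             (combination-+ _ a′ b)

  Span-resp : ∀ {k} (b : Vector Carrierᴹ k) {x y} → x ≈ᴹ y → x ∈ Span b → y ∈ Span b
  Span-resp b x≈y (a , x≈) = a , ≈ᴹ-trans (≈ᴹ-sym x≈y) x≈

  independent-∷ : ∀ {k} {b : Vector Carrierᴹ k} {x} → ¬ (x ∈ Span b) →
                  LinearlyIndependent b → LinearlyIndependent (x ∷ b)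
  independent-∷ {k} {b} {x} x∉ ind a a∙≈0 with a zero ≈? 0#
  ... | yes a₀≈0 = λ { zero → a₀≈0 ; (suc i) → ind (tail a) rest i }
    where
    rest : combination (tail a) b ≈ᴹ 0ᴹ
    rest = begin
      combination (tail a) b                   ≈⟨ +ᴹ-identityˡ _ ⟨
      0ᴹ +ᴹ combination (tail a) b             ≈⟨ +ᴹ-congʳ (*ₗ-zeroˡ x) ⟨
      0# *ₗ x +ᴹ combination (tail a) b        ≈⟨ +ᴹ-congʳ (*ₗ-congʳ a₀≈0) ⟨
      a zero *ₗ x +ᴹ combination (tail a) b    ≈⟨ a∙≈0 ⟩
      0ᴹ                                       ∎
  ... | no a₀≉0 = contradiction (Span-resp b x≈ (combine∈Span b s (tail a , ≈ᴹ-refl) 0∈)) x∉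
    where
    a₀⁻¹ s : Carrier
    a₀⁻¹ = proj₁ (inverse (a zero) a₀≉0)
    s = - a₀⁻¹

    0∈ : 0ᴹ ∈ Span b
    0∈ = (λ _ → 0#) , ≈ᴹ-sym (≈ᴹ-trans (sum-cong-≋ (λ i → *ₗ-zeroˡ (b i)))
                                       (sum-replicate-zero k))

    y : Carrierᴹ
    y = combination (tail a) b

    x+a₀⁻¹y≈0 : x +ᴹ a₀⁻¹ *ₗ y ≈ᴹ 0ᴹ
    x+a₀⁻¹y≈0 = begin
      x +ᴹ a₀⁻¹ *ₗ y
        ≈⟨ +ᴹ-congʳ (*ₗ-identityˡ x) ⟨
      1# *ₗ x +ᴹ a₀⁻¹ *ₗ y
        ≈⟨ +ᴹ-congʳ (*ₗ-congʳ (trans (*-comm _ _) (proj₂ (inverse (a zero) a₀≉0)))) ⟨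
      (a₀⁻¹ * a zero) *ₗ x +ᴹ a₀⁻¹ *ₗ y
        ≈⟨ +ᴹ-congʳ (*ₗ-assoc _ _ _) ⟩
      a₀⁻¹ *ₗ (a zero *ₗ x) +ᴹ a₀⁻¹ *ₗ y
        ≈⟨ *ₗ-distribˡ _ _ _ ⟨
      a₀⁻¹ *ₗ (a zero *ₗ x +ᴹ y)
        ≈⟨ *ₗ-congˡ a∙≈0 ⟩
      a₀⁻¹ *ₗ 0ᴹ
        ≈⟨ *ₗ-zeroʳ _ ⟩
      0ᴹ ∎

    sy+a₀⁻¹y≈0 : s *ₗ y +ᴹ a₀⁻¹ *ₗ y ≈ᴹ 0ᴹ
    sy+a₀⁻¹y≈0 = begin
      s *ₗ y +ᴹ a₀⁻¹ *ₗ y  ≈⟨ *ₗ-distribʳ _ _ _ ⟨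
      (s + a₀⁻¹) *ₗ y      ≈⟨ *ₗ-congʳ (-‿inverseˡ _) ⟩
      0# *ₗ y              ≈⟨ *ₗ-zeroˡ _ ⟩
      0ᴹ                   ∎

    x≈ : s *ₗ y +ᴹ 0ᴹ ≈ᴹ x
    x≈ = begin
      s *ₗ y +ᴹ 0ᴹ     ≈⟨ +ᴹ-identityʳ _ ⟩
      s *ₗ y           ≈⟨ inverseˡ-unique _ _ sy+a₀⁻¹y≈0 ⟩
      -ᴹ (a₀⁻¹ *ₗ y)   ≈⟨ inverseˡ-unique _ _ x+a₀⁻¹y≈0 ⟨
      x                ∎

  finiteDimensional : ∀ {k} (v : Vector Carrierᴹ k) → ∃ (HasDimension (Span v))
  finiteDimensional {zero} v = 0 , [] , record
    { members     = λ ()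
    ; independent = λ _ _ ()
    ; spanning    = λ (_ , x≈) → (λ ()) , x≈
    }
  finiteDimensional {suc k} v with finiteDimensional (tail v)
  ... | r , b , isBasis with ∈Span? b (head v)
  ...   | yes v₀∈ = r , b , record
    { members     = λ i → tail⊆Span v (members i)
    ; independent = independent
    ; spanning    = λ (a , x≈) → Span-resp b (≈ᴹ-sym x≈)
                      (combine∈Span b (head a) v₀∈ (spanning (tail a , ≈ᴹ-refl)))
    }
    where open IsBasis isBasis
  ...   | no v₀∉ = suc r , head v ∷ b , record
    { members     = λ { zero → head∈Span v ; (suc i) → tail⊆Span v (members i) }
    ; independent = independent-∷ v₀∉ independent
    ; spanning    = λ (a , x≈) → Span-resp (head v ∷ b) (≈ᴹ-sym x≈)
                      (combine∈Span (head v ∷ b) (head a) (head∈Span (head v ∷ b))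
                        (tail⊆Span (head v ∷ b) (spanning (tail a , ≈ᴹ-refl))))
    }
    where open IsBasis isBasis

  -- The dimension of Span v.

  dim : ∀ {k} → Vector Carrierᴹ k → ℕ
  dim v = proj₁ (finiteDimensional v)

-- 𝔼 is an extension of 𝔽 of degree m, presented by the embedding ι, and Γ is
-- the 𝔽-basis of 𝔼 used to expand vectors into matrices.

module RankMetric {q m c₁ ℓ₁ c₂ ℓ₂}
  (𝔽 : FiniteField q c₁ ℓ₁) (𝔼 : FiniteField (q ^ m) c₂ ℓ₂)
  (ι : RingHomomorphism (FiniteField.commutativeRing 𝔽) (FiniteField.commutativeRing 𝔼))
  (Γ : Vector (FiniteField.Carrier 𝔼) m)
  (Γ-isBasis : LinearAlgebra.IsBasis
    (restrictScalars (FiniteField.commutativeRing 𝔽) (FiniteField.commutativeRing 𝔼) ι) U Γ)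
  (n : ℕ) where

  private
    module 𝔽 = FiniteField 𝔽
    module 𝔼 = FiniteField 𝔼
    module 𝔼/𝔽 = LinearAlgebra (restrictScalars 𝔽.commutativeRing 𝔼.commutativeRing ι)
    module 𝔽ⁿ = LinearAlgebra (𝔽.commutativeRing ^ᴹ n)
    module 𝔼ⁿ = LinearAlgebra (𝔼.commutativeRing ^ᴹ n)

    _≋?_ : Decidable (Module._≈ᴹ_ (𝔽.commutativeRing ^ᴹ n))
    u ≋? v = Fin.all? (λ i → u i 𝔽.≈? v i)

  open FiniteDimension 𝔽 (𝔽.commutativeRing ^ᴹ n) _≋?_ using (dim; finiteDimensional)
  open Module (𝔼.commutativeRing ^ᴹ n)

  coordinates : 𝔼.Carrier → Vector 𝔽.Carrier m
  coordinates x = proj₁ (𝔼/𝔽.IsBasis.spanning Γ-isBasis {x} _)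

  -- A matrix is the vector of its rows.

  Mat : Carrierᴹ → Vector (Vector 𝔽.Carrier n) m
  Mat x i j = coordinates (x j) i

  σ : Carrierᴹ → Pred (Vector 𝔽.Carrier n) _
  σ x = 𝔽ⁿ.Span (Mat x)

  rk : Carrierᴹ → ℕ
  rk x = dim (Mat x)

  rk-isDimension : ∀ x → 𝔽ⁿ.HasDimension (σ x) (rk x)
  rk-isDimension x = proj₂ (finiteDimensional (Mat x))

  infixl 6 _-ᴹ_
  _-ᴹ_ : Carrierᴹ → Carrierᴹ → Carrierᴹ
  x -ᴹ y = x +ᴹ (-ᴹ y)

  record IsMinimumDistance {p} (C : Pred Carrierᴹ p) (d : ℕ)
                           : Set (c₂ ⊔ ℓ₂ ⊔ p) where
    field
      attained : ∃[ c ] c ∈ C × ¬ (c ≈ᴹ 0ᴹ) × rk c ≡ d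
      minimum  : ∀ c → c ∈ C → ¬ (c ≈ᴹ 0ᴹ) → d ≤ rk c

  record IsCode {p} (C : Pred Carrierᴹ p) (k d : ℕ) : Set (c₂ ⊔ ℓ₂ ⊔ p) where
    field
      isSubspace        : 𝔼ⁿ.IsSubspace C
      hasDimension      : 𝔼ⁿ.HasDimension C k
      k≥1               : 1 ≤ k
      isMinimumDistance : IsMinimumDistance C d

  IsMinimal : ∀ {p} → Pred Carrierᴹ p → Set _
  IsMinimal C = ∀ c c′ → c ∈ C → c′ ∈ C → ¬ (c ≈ᴹ 0ᴹ) → ¬ (c′ ≈ᴹ 0ᴹ) →
                σ c ⊆ σ c′ → ∃[ a ] c′ ≈ᴹ a *ₗ c

  Is⟨2,1⟩-Separating : ∀ {p} → Pred Carrierᴹ p → Set _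
  Is⟨2,1⟩-Separating C = ∀ x y z → x ∈ C → y ∈ C → z ∈ C →
    ¬ (x ≈ᴹ y) → ¬ (y ≈ᴹ z) → ¬ (x ≈ᴹ z) →
    rk (x -ᴹ z) < rk (x -ᴹ y) +ℕ rk (y -ᴹ z)

{-# OPTIONS --safe #-}

-- Suppose rk (x - z) ≥ rk (x - y) + rk (y - z).  Since
-- σ (x - z) ⊆ σ (x - y) + σ (y - z), this forces the two sides to be equal, so
-- that σ (x - y) ⊆ σ (x - z).  Minimality yields x - z = a (x - y), and as
-- scaling does not enlarge supports, rk (x - z) ≤ rk (x - y), which contradicts
-- rk (y - z) > 0.

module Submission where

open import Defs
open import Algebra.Bundles using (CommutativeRing)
open import Algebra.Module.Bundles using (Module)
import Algebra.Properties.CommutativeMonoid.Sum as Sum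
import Algebra.Properties.CommutativeSemigroup as CommutativeSemigroupProperties
import Algebra.Properties.Group as GroupProperties
import Algebra.Properties.Ring as RingProperties
import Algebra.Properties.Semiring.Sum as SemiringSum
open import Data.Fin.Base using (Fin; zero; suc; _↑ˡ_; _↑ʳ_; finToFun; funToFin; combine)
import Data.Fin.Properties as Fin
open import Data.Nat.Base using (ℕ; zero; suc; _≤_; _<_; _^_; z≤n; s≤s; s≤s⁻¹) renaming (_+_ to _+ℕ_)
import Data.Nat.Properties as ℕ
open import Data.Product.Base using (∃-syntax; _×_; _,_; proj₁; proj₂)
open import Data.Unit.Base using (tt)
open import Data.Vec.Functional using (Vector; _∷_; _++_; head; tail)
open import Data.Vec.Functional.Properties using (lookup-++ˡ; lookup-++ʳ)
open import Function.Base using (_∘_)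
open import Function.Bundles using (Inverse)
open import Function.Definitions using (Injective)
open import Relation.Binary.Definitions using (Decidable)
open import Relation.Binary.PropositionalEquality as ≡ using (_≡_; _≗_)
import Relation.Binary.Reasoning.Setoid as SetoidReasoning
open import Relation.Nullary using (¬_; yes; no; contradiction)
open import Relation.Unary using (Pred; U; _∈_; _⊆_)

-- Spans as least subspaces.

module _ {c ℓ m ℓm} {R : CommutativeRing c ℓ} (V : Module R m ℓm) where
  open Module V
  open LinearAlgebra V

  combination∈ : ∀ {p k} {W : Pred Carrierᴹ p} → IsSubspace W → ∀ a (v : Vector Carrierᴹ k) →
                 (∀ i → v i ∈ W) → combination a v ∈ W
  combination∈ {k = zero}  W-sub a v v∈ = IsSubspace.0-closed W-sub
  combination∈ {k = suc k} W-sub a v v∈ =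
    +-closed (*ₗ-closed (head a) (v∈ zero)) (combination∈ W-sub (tail a) (tail v) (v∈ ∘ suc))
    where open IsSubspace W-sub

  Span-least : ∀ {p k} {W : Pred Carrierᴹ p} {v : Vector Carrierᴹ k} → IsSubspace W →
               (∀ i → v i ∈ W) → Span v ⊆ W
  Span-least {v = v} W-sub v∈ (a , x≈) =
    IsSubspace.resp W-sub (≈ᴹ-sym x≈) (combination∈ W-sub a v v∈)

-- Counting vectors over a finite field.

funToFin-cong : ∀ {m n} {f g : Fin m → Fin n} → f ≗ g → funToFin f ≡ funToFin g
funToFin-cong {zero}  f≗g = ≡.refl
funToFin-cong {suc m} f≗g = ≡.cong₂ combine (f≗g zero) (funToFin-cong (f≗g ∘ suc))

module _ {q c ℓ} (F : FiniteField q c ℓ) where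
  open FiniteField F
  private module Enum = Inverse enumeration

  to-injective : ∀ {x y} → Enum.to x ≡ Enum.to y → x ≈ y
  to-injective {x} {y} eq = trans (sym (Enum.strictlyInverseʳ x))
    (trans (Enum.from-cong eq) (Enum.strictlyInverseʳ y))

  -- A field with at most one element would identify 0 and 1. The bound makes `q ^_` strictly
  -- increasing, so that comparing numbers of vectors compares exponents.
  1<q : 1 < q
  1<q = ℕ.≮⇒≥ λ q<2 → 0≉1 (to-injective (collapse (s≤s⁻¹ q<2) _ _))
    where
    collapse : ∀ {r} → r ≤ 1 → (i j : Fin r) → i ≡ j
    collapse (s≤s z≤n) zero zero = ≡.refl

  encode : ∀ {k} → Vector Carrier k → Fin (q ^ k)
  encode v = funToFin (Enum.to ∘ v)

  decode : ∀ k → Fin (q ^ k) → Vector Carrier k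
  decode k i = Enum.from ∘ finToFun i

  encode-injective : ∀ {k} {u v : Vector Carrier k} → encode u ≡ encode v → ∀ i → u i ≈ v i
  encode-injective {u = u} {v} eq i = to-injective (≡.trans
    (≡.sym (Fin.finToFun-funToFin (Enum.to ∘ u) i))
    (≡.trans (≡.cong (λ k → finToFun k i) eq) (Fin.finToFun-funToFin (Enum.to ∘ v) i)))

  -- The hypothesis equates the decoded vectors only entry by entry; `funToFin-cong` takes the place
  -- of function extensionality in passing back to indices.
  decode-injective : ∀ k (i j : Fin (q ^ k)) → (∀ l → decode k i l ≈ decode k j l) → i ≡ j
  decode-injective k i j eq = ≡.trans (≡.sym (Fin.funToFin-finToFin {k} i)) (≡.trans
    (funToFin-cong {k} {f = finToFun i} {g = finToFun j} λ l →
      ≡.trans (≡.sym (Enum.strictlyInverseˡ _))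
        (≡.trans (Enum.to-cong (eq l)) (Enum.strictlyInverseˡ _)))
    (Fin.funToFin-finToFin {k} j))

-- Dimension theory over a finite field.

module SpanDimension {q c ℓ m ℓm} (F : FiniteField q c ℓ)
  (V : Module (FiniteField.commutativeRing F) m ℓm)
  (_≈ᴹ?_ : Decidable (Module._≈ᴹ_ V)) where

  open FiniteField F hiding (zero)
  open Module V
  open LinearAlgebra V
  open FiniteDimension F V _≈ᴹ?_
  open Sum +ᴹ-commutativeMonoid using (sum-cong-≋; sum-replicate-zero)
  open SetoidReasoning ≈ᴹ-setoid

  0∈Span : ∀ {k} (v : Vector Carrierᴹ k) → 0ᴹ ∈ Span v
  0∈Span {k} v = (λ _ → 0#) ,
    ≈ᴹ-sym (≈ᴹ-trans (sum-cong-≋ (λ i → *ₗ-zeroˡ (v i))) (sum-replicate-zero k))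

  Span-isSubspace : ∀ {k} (v : Vector Carrierᴹ k) → IsSubspace (Span v)
  Span-isSubspace v = record
    { resp      = Span-resp v
    ; 0-closed  = 0∈Span v
    ; +-closed  = λ x∈ y∈ → Span-resp v (+ᴹ-congʳ (*ₗ-identityˡ _)) (combine∈Span v 1# x∈ y∈)
    ; *ₗ-closed = λ a x∈ → Span-resp v (+ᴹ-identityʳ _) (combine∈Span v a x∈ (0∈Span v))
    }

  ∈Span : ∀ {k} (v : Vector Carrierᴹ k) i → v i ∈ Span v
  ∈Span v zero    = head∈Span v
  ∈Span v (suc i) = tail⊆Span v (∈Span (tail v) i)

  independent⇒injective : ∀ {k} {v : Vector Carrierᴹ k} → LinearlyIndependent v → ∀ {a b} →
                          combination a v ≈ᴹ combination b v → ∀ i → a i ≈ b i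
  independent⇒injective {v = v} v-ind {a} {b} eq i =
    x∙y⁻¹≈ε⇒x≈y _ _ (trans (+-congˡ (sym (-1*x≈-x _))) (v-ind _ difference≈0 i))
    where
    open GroupProperties +-group using (x∙y⁻¹≈ε⇒x≈y)
    open RingProperties ring using (-1*x≈-x)
    -- Writing the negative as multiplication by `- 1#` lets `combination-+` and `combination-*`
    -- handle the difference.
    difference≈0 : combination (λ i → a i + - 1# * b i) v ≈ᴹ 0ᴹ
    difference≈0 = begin
      combination (λ i → a i + - 1# * b i) v
        ≈⟨ combination-+ a _ v ⟨
      combination a v +ᴹ combination (λ i → - 1# * b i) v
        ≈⟨ +ᴹ-cong eq (≈ᴹ-sym (combination-* (- 1#) b v)) ⟩
      combination b v +ᴹ - 1# *ₗ combination b v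
        ≈⟨ +ᴹ-congʳ (*ₗ-identityˡ _) ⟨
      1# *ₗ combination b v +ᴹ - 1# *ₗ combination b v
        ≈⟨ *ₗ-distribʳ _ _ _ ⟨
      (1# + - 1#) *ₗ combination b v
        ≈⟨ *ₗ-congʳ (-‿inverseʳ 1#) ⟩
      0# *ₗ combination b v
        ≈⟨ *ₗ-zeroˡ _ ⟩
      0ᴹ ∎

  -- Expressing combinations of v through w is an injection of F^s into F^t, so
  -- that q ^ s ≤ q ^ t: counting replaces Steinitz exchange.
  independent-size-≤ : ∀ {s t} {v : Vector Carrierᴹ s} {w : Vector Carrierᴹ t} →
                       LinearlyIndependent v → (∀ i → v i ∈ Span w) → s ≤ t
  independent-size-≤ {s} {t} {v} {w} v-ind v∈ =
    ℕ.≮⇒≥ λ t<s → ℕ.<⇒≱ (ℕ.^-monoʳ-< q (1<q F) t<s) (Fin.injective⇒≤ transfer-injective)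
    where
    in-w : ∀ a → combination a v ∈ Span w
    in-w a = combination∈ V (Span-isSubspace w) a v v∈

    transfer : Fin (q ^ s) → Fin (q ^ t)
    transfer i = encode F (proj₁ (in-w (decode F s i)))

    transfer-injective : Injective _≡_ _≡_ transfer
    transfer-injective {i} {j} eq = decode-injective F s i j (independent⇒injective v-ind (begin
      combination (decode F s i) v
        ≈⟨ proj₂ (in-w (decode F s i)) ⟩
      combination (proj₁ (in-w (decode F s i))) w
        ≈⟨ combination-cong w (encode-injective F eq) ⟩
      combination (proj₁ (in-w (decode F s j))) w
        ≈⟨ proj₂ (in-w (decode F s j)) ⟨
      combination (decode F s j) v ∎))

  -- A vector of `Span w` outside `Span v` would extend `v` to `suc s` independent vectors in
  -- `Span w`, forcing `suc s ≤ t`. Membership in `Span v` is decidable, so the argument by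
  -- contradiction is constructive.
  independent⇒spanning : ∀ {s t} {v : Vector Carrierᴹ s} {w : Vector Carrierᴹ t} →
                         LinearlyIndependent v → (∀ i → v i ∈ Span w) → t ≤ s →
                         Span w ⊆ Span v
  independent⇒spanning {v = v} {w} v-ind v∈ t≤s {x} x∈ with ∈Span? v x
  ... | yes x∈v = x∈v
  ... | no  x∉v = contradiction
    (independent-size-≤ {v = x ∷ v} {w} (independent-∷ x∉v v-ind) λ { zero → x∈ ; (suc i) → v∈ i })
    (ℕ.<⇒≱ (s≤s t≤s))

  dimension-mono : ∀ {p₁ p₂ r s} {W : Pred Carrierᴹ p₁} {X : Pred Carrierᴹ p₂} → W ⊆ X →
                   HasDimension W r → HasDimension X s → r ≤ s
  dimension-mono W⊆X (b , b-basis) (_ , d-basis) =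
    independent-size-≤ (independent b-basis) (λ i → spanning d-basis (W⊆X (members b-basis i)))
    where open IsBasis

  -- The splitting places the basis `b` of `W` inside the span of `b₁ ++ b₂`. With at least
  -- `r₁ +ℕ r₂` independent members, `b` must span all of it, and `W₁` lies in that span.
  summand⊆sum : ∀ {p r₁ r₂ r} {W₁ W₂ W : Pred Carrierᴹ p} → IsSubspace W →
    HasDimension W₁ r₁ → HasDimension W₂ r₂ → HasDimension W r →
    (∀ {x} → x ∈ W → ∃[ y ] ∃[ z ] y ∈ W₁ × z ∈ W₂ × x ≈ᴹ y +ᴹ z) →
    r₁ +ℕ r₂ ≤ r → W₁ ⊆ W
  summand⊆sum {r₁ = r₁} {r₂} {W₁ = W₁} {W₂} W-sub (b₁ , basis₁) (b₂ , basis₂) (b , basis) split r₁+r₂≤r x∈ =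
    Span-least V W-sub (members basis)
      (independent⇒spanning {w = b₁ ++ b₂} (independent basis) b∈ r₁+r₂≤r (W₁⊆ x∈))
    where
    open IsBasis
    sub : IsSubspace (Span (b₁ ++ b₂))
    sub = Span-isSubspace (b₁ ++ b₂)

    W₁⊆ : W₁ ⊆ Span (b₁ ++ b₂)
    W₁⊆ y∈ = Span-least V sub
      (λ i → ≡.subst (Span (b₁ ++ b₂)) (lookup-++ˡ b₁ b₂ i) (∈Span (b₁ ++ b₂) (i ↑ˡ r₂)))
      (spanning basis₁ y∈)

    W₂⊆ : W₂ ⊆ Span (b₁ ++ b₂)
    W₂⊆ y∈ = Span-least V sub
      (λ i → ≡.subst (Span (b₁ ++ b₂)) (lookup-++ʳ b₁ b₂ i) (∈Span (b₁ ++ b₂) (r₁ ↑ʳ i)))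
      (spanning basis₂ y∈)

    b∈ : ∀ i → b i ∈ Span (b₁ ++ b₂)
    b∈ i with split (members basis i)
    ... | _ , _ , y∈ , z∈ , x≈ =
      IsSubspace.resp sub (≈ᴹ-sym x≈) (IsSubspace.+-closed sub (W₁⊆ y∈) (W₂⊆ z∈))

-- Coordinates, supports and rank.

module _ {c ℓ} (R : CommutativeRing c ℓ) (n : ℕ) where
  open CommutativeRing R hiding (zero)
  open LinearAlgebra (R ^ᴹ n)
  open Sum +-commutativeMonoid using (sum)

  combination-lookup : ∀ {k} a (v : Vector (Vector Carrier n) k) j →
                       combination a v j ≡ sum (λ i → a i * v i j)
  combination-lookup {zero}  a v j = ≡.refl
  combination-lookup {suc k} a v j =
    ≡.cong (a zero * v zero j +_) (combination-lookup (tail a) (tail v) j)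

module RankMetricProperties {q m c₁ ℓ₁ c₂ ℓ₂}
  (𝔽 : FiniteField q c₁ ℓ₁) (𝔼 : FiniteField (q ^ m) c₂ ℓ₂)
  (ι : RingHomomorphism (FiniteField.commutativeRing 𝔽) (FiniteField.commutativeRing 𝔼))
  (Γ : Vector (FiniteField.Carrier 𝔼) m)
  (Γ-isBasis : LinearAlgebra.IsBasis
    (restrictScalars (FiniteField.commutativeRing 𝔽) (FiniteField.commutativeRing 𝔼) ι) U Γ)
  (n : ℕ) where

  private
    module 𝔽 = FiniteField 𝔽
    module 𝔼 = FiniteField 𝔼
    E/F = restrictScalars 𝔽.commutativeRing 𝔼.commutativeRing ι
    Fⁿ = 𝔽.commutativeRing ^ᴹ n
    Eⁿ = 𝔼.commutativeRing ^ᴹ n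
    module E/F = Module E/F
    module Fⁿ = Module Fⁿ
    module Eⁿ = Module Eⁿ
    module LE = LinearAlgebra E/F
    module LF = LinearAlgebra Fⁿ
    module E/F-dim = FiniteDimension 𝔽 E/F 𝔼._≈?_
    module E/F-span = SpanDimension 𝔽 E/F 𝔼._≈?_
    module Fⁿ-dim = FiniteDimension 𝔽 Fⁿ (λ u v → Fin.all? (λ i → u i 𝔽.≈? v i))
    module Fⁿ-span = SpanDimension 𝔽 Fⁿ (λ u v → Fin.all? (λ i → u i 𝔽.≈? v i))
    open RingHomomorphism ι using (⟦_⟧)
    module F-sum = Sum 𝔽.+-commutativeMonoid
  open RankMetric 𝔽 𝔼 ι Γ Γ-isBasis n

  coordinates-expand : ∀ x → x 𝔼.≈ LE.combination (coordinates x) Γ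
  coordinates-expand x = proj₂ (LE.IsBasis.spanning Γ-isBasis {x} tt)

  -- `coordinates` is merely the witness chosen by the spanning property; independence of `Γ` makes
  -- it the only possible one. Compatibility with equality and 𝔽-linearity then follow by exhibiting
  -- expansions.
  coordinates-unique : ∀ {x} a → x 𝔼.≈ LE.combination a Γ → ∀ i → coordinates x i 𝔽.≈ a i
  coordinates-unique {x} a x≈ = E/F-span.independent⇒injective (LE.IsBasis.independent Γ-isBasis)
    (𝔼.trans (𝔼.sym (coordinates-expand x)) x≈)

  coordinates-cong : ∀ {x y} → x 𝔼.≈ y → ∀ i → coordinates x i 𝔽.≈ coordinates y i
  coordinates-cong {y = y} x≈y = coordinates-unique _ (𝔼.trans x≈y (coordinates-expand y))

  coordinates-+ : ∀ x y i → coordinates (x 𝔼.+ y) i 𝔽.≈ coordinates x i 𝔽.+ coordinates y i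
  coordinates-+ x y = coordinates-unique _ (𝔼.trans
    (𝔼.+-cong (coordinates-expand x) (coordinates-expand y)) (E/F-dim.combination-+ _ _ Γ))

  coordinates-* : ∀ a x i → coordinates (⟦ a ⟧ 𝔼.* x) i 𝔽.≈ a 𝔽.* coordinates x i
  coordinates-* a x = coordinates-unique _ (𝔼.trans
    (𝔼.*-congˡ (coordinates-expand x)) (E/F-dim.combination-* a _ Γ))

  coordinates-0 : ∀ i → coordinates 𝔼.0# i 𝔽.≈ 𝔽.0#
  coordinates-0 = coordinates-unique _ (proj₂ (E/F-span.0∈Span Γ))

  coordinates-combination : ∀ {k} a (v : Vector 𝔼.Carrier k) i →
    coordinates (LE.combination a v) i 𝔽.≈ F-sum.sum (λ j → a j 𝔽.* coordinates (v j) i)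
  coordinates-combination {zero}  a v i = coordinates-0 i
  coordinates-combination {suc k} a v i = 𝔽.trans (coordinates-+ _ _ i)
    (𝔽.+-cong (coordinates-* _ _ i) (coordinates-combination (tail a) (tail v) i))

  *-combination : ∀ {k} s a (v : Vector 𝔼.Carrier k) →
                  s 𝔼.* LE.combination a v 𝔼.≈ LE.combination a (λ i → s 𝔼.* v i)
  *-combination s a v = 𝔼.trans (*-distribˡ-sum s (λ i → ⟦ a i ⟧ 𝔼.* v i))
    (sum-cong-≋ λ i → x∙yz≈y∙xz s ⟦ a i ⟧ (v i))
    where
    open SemiringSum 𝔼.semiring using (*-distribˡ-sum)
    open Sum 𝔼.+-commutativeMonoid using (sum-cong-≋)
    open CommutativeSemigroupProperties 𝔼.*-commutativeSemigroup using (x∙yz≈y∙xz)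

  σ-cong : ∀ {x y} → x Eⁿ.≈ᴹ y → σ x ⊆ σ y
  σ-cong {x} {y} x≈y = Span-least Fⁿ (Fⁿ-span.Span-isSubspace (Mat y)) λ i →
    Fⁿ-dim.Span-resp (Mat y) (λ j → coordinates-cong (𝔼.sym (x≈y j)) i) (Fⁿ-span.∈Span (Mat y) i)

  -- Multiplication by `s` is an 𝔽-linear map of 𝔼, so it acts on `Mat x` by a matrix on the left,
  -- and this only combines rows.
  σ-scale : ∀ s x → σ (s Eⁿ.*ₗ x) ⊆ σ x
  σ-scale s x = Span-least Fⁿ (Fⁿ-span.Span-isSubspace (Mat x)) λ i → weights i , row i
    where
    weights : Fin m → Vector 𝔽.Carrier m
    -- Row `i` of the matrix of multiplication by `s` in the basis `Γ`.
    weights i l = coordinates (s 𝔼.* Γ l) i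

    open SetoidReasoning 𝔽.setoid
    row : ∀ i j → Mat (s Eⁿ.*ₗ x) i j 𝔽.≈ LF.combination (weights i) (Mat x) j
    row i j = begin
      coordinates (s 𝔼.* x j) i
        ≈⟨ coordinates-cong (𝔼.trans (𝔼.*-congˡ (coordinates-expand (x j)))
                                     (*-combination s _ Γ)) i ⟩
      coordinates (LE.combination (coordinates (x j)) (λ l → s 𝔼.* Γ l)) i
        ≈⟨ coordinates-combination (coordinates (x j)) _ i ⟩
      F-sum.sum (λ l → coordinates (x j) l 𝔽.* coordinates (s 𝔼.* Γ l) i)
        ≈⟨ F-sum.sum-cong-≋ (λ l → 𝔽.*-comm (coordinates (x j) l) (weights i l)) ⟩
      F-sum.sum (λ l → weights i l 𝔽.* Mat x l j)
        ≡⟨ combination-lookup 𝔽.commutativeRing n (weights i) (Mat x) j ⟨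
      LF.combination (weights i) (Mat x) j ∎

  rk-mono : ∀ {x y} → σ x ⊆ σ y → rk x ≤ rk y
  rk-mono {x} {y} σx⊆σy = Fⁿ-span.dimension-mono σx⊆σy (rk-isDimension x) (rk-isDimension y)

  rk-positive : ∀ {x} → ¬ (x Eⁿ.≈ᴹ Eⁿ.0ᴹ) → 0 < rk x
  rk-positive {x} x≉0 with rk x | rk-isDimension x
  ... | suc _ | _           = s≤s z≤n
  ... | zero  | _ , isBasis = contradiction x≈0 x≉0
    where
    Mat≈0 : ∀ i j → Mat x i j 𝔽.≈ 𝔽.0#
    -- The basis is empty here, so a combination of it is the zero vector by computation.
    Mat≈0 i = proj₂ (LF.IsBasis.spanning isBasis (Fⁿ-span.∈Span (Mat x) i))

    x≈0 : x Eⁿ.≈ᴹ Eⁿ.0ᴹ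
    x≈0 j = 𝔼.trans (coordinates-expand (x j)) (𝔼.trans
      (E/F-dim.combination-cong Γ (λ i → Mat≈0 i j)) (𝔼.sym (proj₂ (E/F-span.0∈Span Γ))))

  -- `Mat` is additive, so the coefficients `a` that express `u` serve for both summands.
  σ-+ : ∀ x y {u} → u ∈ σ (x Eⁿ.+ᴹ y) → ∃[ v ] ∃[ w ] v ∈ σ x × w ∈ σ y × u Fⁿ.≈ᴹ v Fⁿ.+ᴹ w
  σ-+ x y (a , u≈) = _ , _ , (a , Fⁿ.≈ᴹ-refl) , (a , Fⁿ.≈ᴹ-refl) , Fⁿ.≈ᴹ-trans u≈
    (Fⁿ.≈ᴹ-trans
      (Fⁿ-sum.sum-cong-≋ λ i → Fⁿ.≈ᴹ-trans (Fⁿ.*ₗ-congˡ λ j → coordinates-+ (x j) (y j) i)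
        (Fⁿ.*ₗ-distribˡ (a i) (Mat x i) (Mat y i)))
      (Fⁿ-sum.∑-distrib-+ (λ i → a i Fⁿ.*ₗ Mat x i) (λ i → a i Fⁿ.*ₗ Mat y i)))
    where module Fⁿ-sum = Sum Fⁿ.+ᴹ-commutativeMonoid

  rk-additive⇒σ⊆ : ∀ x y → rk x +ℕ rk y ≤ rk (x Eⁿ.+ᴹ y) → σ x ⊆ σ (x Eⁿ.+ᴹ y)
  rk-additive⇒σ⊆ x y = Fⁿ-span.summand⊆sum (Fⁿ-span.Span-isSubspace (Mat (x Eⁿ.+ᴹ y)))
    (rk-isDimension x) (rk-isDimension y) (rk-isDimension (x Eⁿ.+ᴹ y)) (σ-+ x y)

  -- Differences of codewords and separation.

  -ᴹ-telescope : ∀ x y z → (x -ᴹ y) Eⁿ.+ᴹ (y -ᴹ z) Eⁿ.≈ᴹ x -ᴹ z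
  -ᴹ-telescope x y z j = begin
    (x j 𝔼.+ 𝔼.- y j) 𝔼.+ (y j 𝔼.+ 𝔼.- z j)  ≈⟨ 𝔼.+-assoc _ _ _ ⟩
    x j 𝔼.+ (𝔼.- y j 𝔼.+ (y j 𝔼.+ 𝔼.- z j))  ≈⟨ 𝔼.+-congˡ (\\-leftDividesʳ (y j) _) ⟩
    x j 𝔼.+ 𝔼.- z j                          ∎
    where
    open SetoidReasoning 𝔼.setoid
    open GroupProperties 𝔼.+-group using (\\-leftDividesʳ)

  -- Negatives arise from closure under scaling by -1.
  -ᴹ-closed : ∀ {p} {C : Pred Eⁿ.Carrierᴹ p} → LinearAlgebra.IsSubspace Eⁿ C →
              ∀ {x y} → x ∈ C → y ∈ C → x -ᴹ y ∈ C
  -ᴹ-closed C-sub x∈ y∈ =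
    +-closed x∈ (resp (λ j → -1*x≈-x _) (*ₗ-closed (𝔼.- 𝔼.1#) y∈))
    where
    open LinearAlgebra.IsSubspace C-sub
    open RingProperties 𝔼.ring using (-1*x≈-x)

  minimal⇒separating : ∀ {p} {C : Pred Eⁿ.Carrierᴹ p} → LinearAlgebra.IsSubspace Eⁿ C →
                       IsMinimal C → Is⟨2,1⟩-Separating C
  minimal⇒separating C-sub minimal x y z x∈ y∈ z∈ x≉y y≉z x≉z = ℕ.≰⇒> λ rk-sum≤ →
    let σ⊆ = λ {u} u∈ → σ-cong telescope (rk-additive⇒σ⊆ (x -ᴹ y) (y -ᴹ z)
               -- Vectors equal up to `≈ᴹ` have the same support, which carries the rank bound from
               -- `x -ᴹ z` to the telescoping sum.
               (ℕ.≤-trans rk-sum≤ (rk-mono (σ-cong (Eⁿ.≈ᴹ-sym telescope)))) {u} u∈)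
        a , x-z≈ = minimal (x -ᴹ y) (x -ᴹ z) (-ᴹ-closed C-sub x∈ y∈) (-ᴹ-closed C-sub x∈ z∈)
                     (nonzero x≉y) (nonzero x≉z) σ⊆
        rk≤ = rk-mono λ u∈ → σ-scale a (x -ᴹ y) (σ-cong x-z≈ u∈)
    -- The cycle is `rk (x -ᴹ y)` < `rk (x -ᴹ y) +ℕ rk (y -ᴹ z)` ≤ `rk (x -ᴹ z)` ≤ `rk (x -ᴹ y)`.
    in ℕ.<-irrefl ≡.refl (ℕ.<-≤-trans
         (ℕ.m<m+n (rk (x -ᴹ y)) (rk-positive (nonzero y≉z))) (ℕ.≤-trans rk-sum≤ rk≤))
    where
    open GroupProperties 𝔼.+-group using (x∙y⁻¹≈ε⇒x≈y)

    telescope : (x -ᴹ y) Eⁿ.+ᴹ (y -ᴹ z) Eⁿ.≈ᴹ x -ᴹ z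
    telescope = -ᴹ-telescope x y z

    nonzero : ∀ {u v} → ¬ (u Eⁿ.≈ᴹ v) → ¬ (u -ᴹ v Eⁿ.≈ᴹ Eⁿ.0ᴹ)
    nonzero u≉v u-v≈0 = u≉v λ j → x∙y⁻¹≈ε⇒x≈y _ _ (u-v≈0 j)

theorem5p5 : ∀ {c₁ ℓ₁ c₂ ℓ₂ p} (q m n : ℕ) → IsPrimePower q → 1 ≤ m → 1 ≤ n →
    (𝔽 : FiniteField q c₁ ℓ₁) (𝔼 : FiniteField (q ^ m) c₂ ℓ₂) →
    let module 𝔽 = FiniteField 𝔽
        module 𝔼 = FiniteField 𝔼 in
    (ι : RingHomomorphism 𝔽.commutativeRing 𝔼.commutativeRing) →
    let module 𝔼/𝔽 = LinearAlgebra (restrictScalars 𝔽.commutativeRing 𝔼.commutativeRing ι) in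
    (Γ : Vector 𝔼.Carrier m) (Γ-isBasis : 𝔼/𝔽.IsBasis U Γ) →
    let open RankMetric 𝔽 𝔼 ι Γ Γ-isBasis n in
    (C : Pred (Vector 𝔼.Carrier n) p) (k d : ℕ) →
    IsCode C k d → IsMinimal C → Is⟨2,1⟩-Separating C
theorem5p5 q m n _ _ _ 𝔽 𝔼 ι Γ Γ-isBasis C k d isCode =
  minimal⇒separating (RankMetric.IsCode.isSubspace isCode)
  where open RankMetricProperties 𝔽 𝔼 ι Γ Γ-isBasis n
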